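{- Let $B(u)$ be the generating matrix of the reflection algebra $\mathcal B(n,l)$. For $\kappa=(k_1,\dots,k_n)\in I_n$ put $$Q_\kappa^{ -1}=P_{1k_1}\cdots P_{nk_n},$$ denote the corresponding element of the symmetric group by $$q_\kappa=(n,k_n)(n-1,k_{n-1})\cdots(1,k_1)\in S_n,$$ and define $$q_\kappa^{[i]}=(n,k_n)(n-1,k_{n-1})\cdots(i,k_i)\in S_n\qquad(i=1,\dots,n).$$ Then $$\langle\langle B_1,\dots,B_n\rangle\rangle=\sum_{\kappa\in I_n}\alpha(\kappa)\,Q_\kappa^{ -1}\,B_{q_\kappa^{[1]}(1)}(u)\,B_{q_\kappa^{[2]}(2)}(u-1)\cdots B_{q_\kappa^{[n]}(n)}(u-n+1),$$ where $q_\kappa^{[i]}(j)$ is the result of the action of the permutation $q_\kappa^{[i]}$ on $j$.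
   Context: Reflection algebra. Let $n=m+l$ with $m,l$ nonnegative integers, and $\varepsilon_i=1$ for $1\le i\le m$, $\varepsilon_i=-1$ for $m<i\le n$. Let $P:v\otimes w\mapsto w\otimes v$ on $\mathbb C^n\otimes\mathbb C^n$ and $R(u)=1-P/u$. The reflection algebra $\mathcal B(n,l)$ is the unital associative algebra over $\mathbb C$ with generators $b_{ij}^{(r)}$ ($i,j=1,\dots,n$, $r=0,1,2,\dots$), $b_{ij}^{(0)}=\delta_{ij}\varepsilon_i$, collected into series $b_i^j(u)=\sum_{r\ge0}b_{ij}^{(r)}u^{ -r}$ and the matrix $B(u)=\sum_{i,j}E_{ij}\otimes b_i^j(u)\in\operatorname{End}\mathbb C^n\otimes\mathcal B(n,l)[[u^{ -1}]]$, subject to the reflection equation $R(u-v)B_1(u)R(u+v)B_2(v)=B_2(v)R(u+v)B_1(u)R(u-v)$ and the unitary condition $B(u)B(-u)=1$. For a matrix $X=(x_{ij})$ over an associative algebra $A$, $X_s=\sum_{i,j}1\otimes\cdots\otimes E_{ij}\otimes\cdots\otimes1\otimes x_{ij}\in\operatorname{End}(\mathbb C^n)^{\otimes n}\otimes A$ with $E_{ij}$ in the $s$-th position; $P_{ij}$ denotes $P$ acting on the $i$-th and $j$-th copies of $\mathbb C^n$ in $(\mathbb C^n)^{\otimes n}$, and $P_{kk}$ is the identity; likewise $(k,k)$ is the identity permutation and $(i,j)$ denotes a transposition. Products of permutations are composed from right to left. Shifted series and rational functions of $u$ are expanded as power series in $u^{ -1}$. For $k=1,\dots,n$ put $\Pi_k=1-(2u-k-n+2)^{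 -1}\sum_{i=k+1}^nP_{ki}$, and $$\langle\langle B_1,\dots,B_n\rangle\rangle=B_1(u)\Pi_1B_2(u-1)\Pi_2\cdots B_{n-1}(u-n+2)\Pi_{n-1}B_n(u-n+1).$$ $I_n\subset\mathbb Z^n$ is the set of $n$-tuples $\kappa=(k_1,\dots,k_n)$ with $i\le k_i\le n$ for all $i=1,\dots,n$, and $\alpha(\kappa)=\prod_{i:\,i<k_i}\frac{1}{n-2u-2+i}$. -}

module Defs where

open import Algebra.Apartness.Bundles using (HeytingCommutativeRing; HeytingField)
open import Algebra.Bundles using (CommutativeRing; Ring)
open import Algebra.Bundles.Raw using (RawMonoid; RawRing)
import Algebra.Definitions.RawMonoid as RawMonoidDefs
import Algebra.Definitions.RawSemiring as RawSemiringDefs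
open import Data.Bool.Base using (if_then_else_)
open import Data.Fin.Base as Fin using (Fin; zero; suc; toℕ; splitAt)
open import Data.Fin.Patterns using (0F; 1F)
import Data.Fin.Permutation as Perm
open import Data.Fin.Properties as Fin using (all?)
open import Data.Integer.Base as ℤ using (ℤ)
open import Data.Nat.Base as ℕ using (ℕ; zero; suc; _∸_)
open import Data.Product.Base using (_×_; _,_; proj₁)
open import Data.Sum.Base using ([_,_]′)
open import Data.Vec.Base using (Vec; []; _∷_; lookup; tabulate)
import Data.Vec.Functional as Vector
open import Data.Vec.Properties using (≡-dec)
open import Function.Base using (_∘_; const)
open import Level using (_⊔_)
open import Relation.Binary.PropositionalEquality.Core using (_≡_)
open import Relation.Nullary.Decidable using (Dec; does; _⊎-dec_)

-- Throughout, a position i ∈ {1,…,n} is an element of Fin n, whose numerical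
-- value is this:

num : ∀ {n} → Fin n → ℕ
num i = suc (toℕ i)

∑Vec : ∀ {a ℓ} (M : RawMonoid a ℓ) {N} k → (Vec (Fin N) k → RawMonoid.Carrier M) →
       RawMonoid.Carrier M
∑Vec M zero    f = f []
∑Vec M (suc k) f = RawMonoidDefs.sum M λ i → ∑Vec M k (f ∘ (i ∷_))

-- Formal power series R[[u⁻¹]]: f represents Σ_r (f r) u⁻ʳ

Series : ∀ {c ℓ} → RawRing c ℓ → RawRing c ℓ
Series R = record
  { Carrier = ℕ → Carrier
  ; _≈_     = λ f g → ∀ r → f r ≈ g r
  ; _+_     = λ f g r → f r + g r
  ; _*_     = λ f g r → sum {suc r} λ s → f (toℕ s) * g (r ∸ toℕ s)
  ; -_      = λ f r → - f r
  ; 0#      = λ _ → 0#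
  ; 1#      = λ { zero → 1# ; (suc _) → 0# }
  }
  where
  open RawRing R
  open RawSemiringDefs rawSemiring using (sum)

module SeriesOps {c ℓ} (R : RawRing c ℓ) where
  open RawRing R
  open RawSemiringDefs rawSemiring using (sum; _^_)
  private
    module S = RawRing (Series R)
    module SD = RawSemiringDefs S.rawSemiring

  constant : Carrier → S.Carrier
  constant a zero    = a
  constant a (suc _) = 0#

  -- recip a⁻¹ b is the expansion of 1/(au + b) in u⁻¹, for a with inverse a⁻¹:
  --   1/(au + b) = Σ_{r≥0} (-b)ʳ a⁻⁽ʳ⁺¹⁾ u⁻⁽ʳ⁺¹⁾.
  recip : Carrier → Carrier → S.Carrier
  recip a⁻¹ b zero    = 0#
  recip a⁻¹ b (suc r) = (- b) ^ r * a⁻¹ ^ suc r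

  -- f ∘[u⁻¹↦ w ] = Σ_r (f r) wʳ, for w without constant term (so that wʳ does
  -- not contribute to the coefficient of u⁻ˢ when r > s).
  _∘[u⁻¹↦_] : S.Carrier → S.Carrier → S.Carrier
  (f ∘[u⁻¹↦ w ]) s = sum {suc s} λ r → f (toℕ r) * (w SD.^ toℕ r) s

-- Formal Laurent series R((v⁻¹)): (d , f) represents vᵈ Σ_k (f k) v⁻ᵏ

Laurent : ∀ {c ℓ} → RawRing c ℓ → RawRing c ℓ
Laurent R = record
  { Carrier = ℕ × S.Carrier
  ; _≈_     = λ x y → ∀ s → coeff x s ≈ coeff y s
  ; _+_     = λ (d , f) (e , g) → d ℕ.+ e , delay e f S.+ delay d g
  ; _*_     = λ (d , f) (e , g) → d ℕ.+ e , f S.* g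
  ; -_      = λ (d , f) → d , S.- f
  ; 0#      = 0 , S.0#
  ; 1#      = 0 , S.1#
  }
  module Laurent where
  open RawRing R
  module S = RawRing (Series R)

  -- delay e f = v⁻ᵉ f
  delay : ℕ → S.Carrier → S.Carrier
  delay zero    f k       = f k
  delay (suc e) f zero    = 0#
  delay (suc e) f (suc k) = delay e f k

  -- The coefficient of vˢ.
  coeff : ℕ × S.Carrier → ℤ → Carrier
  coeff (d , f) s with ℤ.+ d ℤ.- s
  ... | ℤ.+ k      = f k
  ... | ℤ.-[1+ _ ] = 0#

-- End(Kᴺ)^{⊗k} ⊗ R, as matrices over R indexed by the basis
-- e_I = e_{I₁} ⊗ ⋯ ⊗ e_{Iₖ} of (Kᴺ)^{⊗k}

TensorEnd : ∀ {c ℓ} → RawRing c ℓ → ℕ → ℕ → RawRing c ℓ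
TensorEnd R N k = record
  { Carrier = Index → Index → Carrier
  ; _≈_     = λ X Y → ∀ I J → X I J ≈ Y I J
  ; _+_     = λ X Y I J → X I J + Y I J
  ; _*_     = λ X Y I J → ∑Vec +-rawMonoid k λ K → X I K * Y K J
  ; -_      = λ X I J → - X I J
  ; 0#      = λ _ _ → 0#
  ; 1#      = λ I J → if does (≡-dec Fin._≟_ I J) then 1# else 0#
  }
  where
  open RawRing R
  Index = Vec (Fin N) k

module TensorEndOps {c ℓ} (R : RawRing c ℓ) (N k : ℕ) where
  open RawRing R
  private module E = RawRing (TensorEnd R N k)

  infixr 8 _•_
  _•_ : Carrier → E.Carrier → E.Carrier
  (a • X) I J = a * X I J

  -- X_s = Σ_{i,j} 1 ⊗ ⋯ ⊗ E_{ij} ⊗ ⋯ ⊗ 1 ⊗ x_{ij}: the entry at (I , J) is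
  -- x_{I_s J_s} if I and J agree in all positions other than s, and 0 otherwise.
  infix 9 _at_
  _at_ : (Fin N → Fin N → Carrier) → Fin k → E.Carrier
  (X at s) I J =
    if does (all? λ t → (t Fin.≟ s) ⊎-dec (lookup I t Fin.≟ lookup J t))
    then X (lookup I s) (lookup J s)
    else 0#

  -- P_{st} e_J = e_{J′}, where J′ is J with its s-th and t-th entries exchanged.
  P : Fin k → Fin k → E.Carrier
  P s t I J = if does (≡-dec Fin._≟_ I J′) then 1# else 0#
    where J′ = tabulate λ p → lookup J (Perm.transpose s t Perm.⟨$⟩ʳ p)

-- The ground field ℂ is replaced by an arbitrary field of characteristic zero.
-- HeytingField is used because its nonzero elements (x # 0#) come with inverses.

module _ {c ℓ₁ ℓ₂} (K : HeytingField c ℓ₁ ℓ₂) where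
  open HeytingField K

  private
    K-commutativeRing = HeytingCommutativeRing.commutativeRing heytingCommutativeRing
    module KD = RawMonoidDefs (CommutativeRing.+-rawMonoid K-commutativeRing)

  CharacteristicZero : Set ℓ₂
  CharacteristicZero = ∀ k → (suc k KD.× 1#) # 0#

  half : CharacteristicZero → Carrier
  half char0 = proj₁ (#⇒invertible (char0 1))

-- The reflection algebra 𝓑(n,l), n = m + l, as a presented K-algebra:
-- non-commutative expressions in the generators modulo the least congruence
-- containing the axioms of unital associative K-algebras and the relations

module Presentation {c ℓ₁ ℓ₂} (K : HeytingField c ℓ₁ ℓ₂) (m l : ℕ) where
  private module K = HeytingField K

  n : ℕ
  n = m ℕ.+ l

  infix  8 -_
  infixl 7 _*_
  infixl 6 _+_
  data Term : Set c where
    scal : K.Carrier → Term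
    gen  : Fin n → Fin n → ℕ → Term
    _+_  : Term → Term → Term
    _*_  : Term → Term → Term
    -_   : Term → Term

  0# 1# : Term
  0# = scal K.0#
  1# = scal K.1#

  -- Expressions up to syntactic equality; only the operations matter.
  termRawRing : RawRing c c
  termRawRing = record
    { Carrier = Term ; _≈_ = _≡_ ; _+_ = _+_ ; _*_ = _*_ ; -_ = -_ ; 0# = 0# ; 1# = 1# }

  ε : Fin n → Term
  ε i = [ const 1# , const (- 1#) ]′ (splitAt m i)

  private
    module T = RawSemiringDefs (RawRing.rawSemiring termRawRing)
    module S = RawRing (Series termRawRing)
    module SD = RawSemiringDefs S.rawSemiring

  B[u] : Fin n → Fin n → S.Carrier
  B[u] i j r = gen i j r

  B[-u] : Fin n → Fin n → S.Carrier
  B[-u] i j r = (- 1#) T.^ r * gen i j r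

  -- Both sides of the reflection equation, in End(Kⁿ)^{⊗2} ⊗ 𝓑((v⁻¹))[[u⁻¹]],
  -- with (u ± v)⁻¹ expanded in u⁻¹.
  module ReflectionEquation where
    private
      module V  = RawRing (Laurent termRawRing)
      module UV = RawRing (Series (Laurent termRawRing))
    module E = RawRing (TensorEnd (Series (Laurent termRawRing)) n 2)
    open SeriesOps (Laurent termRawRing) using (constant; recip)
    open TensorEndOps (Series (Laurent termRawRing)) n 2

    v : V.Carrier
    v = 1 , S.1#

    -- R(w) = 1 - P/w as a function of w⁻¹.
    R : UV.Carrier → E.Carrier
    R w⁻¹ = E.1# E.+ E.- (w⁻¹ • P 0F 1F)

    R[u-v] R[u+v] B₁[u] B₂[v] : E.Carrier
    R[u-v] = R (recip V.1# (V.- v))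
    R[u+v] = R (recip V.1# v)
    B₁[u]  = (λ i j r → 0 , SeriesOps.constant termRawRing (B[u] i j r)) at 0F
    B₂[v]  = (λ i j → constant (0 , B[u] i j)) at 1F

    lhs rhs : E.Carrier
    lhs = R[u-v] E.* B₁[u] E.* R[u+v] E.* B₂[v]
    rhs = B₂[v] E.* R[u+v] E.* B₁[u] E.* R[u-v]

  private module RE = ReflectionEquation

  infix 4 _∼_
  data _∼_ : Term → Term → Set (c ⊔ ℓ₁) where
    ∼-refl  : ∀ {x} → x ∼ x
    ∼-sym   : ∀ {x y} → x ∼ y → y ∼ x
    ∼-trans : ∀ {x y z} → x ∼ y → y ∼ z → x ∼ z
    +-cong  : ∀ {x x′ y y′} → x ∼ x′ → y ∼ y′ → x + y ∼ x′ + y′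
    *-cong  : ∀ {x x′ y y′} → x ∼ x′ → y ∼ y′ → x * y ∼ x′ * y′
    -‿cong  : ∀ {x x′} → x ∼ x′ → - x ∼ - x′

    +-assoc     : ∀ x y z → (x + y) + z ∼ x + (y + z)
    +-comm      : ∀ x y → x + y ∼ y + x
    +-identityˡ : ∀ x → 0# + x ∼ x
    -‿inverseˡ  : ∀ x → - x + x ∼ 0#
    *-assoc     : ∀ x y z → (x * y) * z ∼ x * (y * z)
    *-identityˡ : ∀ x → 1# * x ∼ x
    *-identityʳ : ∀ x → x * 1# ∼ x
    distribˡ    : ∀ x y z → x * (y + z) ∼ x * y + x * z
    distribʳ    : ∀ x y z → (y + z) * x ∼ y * x + z * x

    scal-cong    : ∀ {a b} → a K.≈ b → scal a ∼ scal b
    scal-+       : ∀ a b → scal (a K.+ b) ∼ scal a + scal b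
    scal-*       : ∀ a b → scal (a K.* b) ∼ scal a * scal b
    scal-central : ∀ a x → scal a * x ∼ x * scal a

    initial    : ∀ i j → gen i j 0 ∼ (if does (i Fin.≟ j) then ε i else 0#)
    reflection : ∀ I J r s → Laurent.coeff termRawRing (RE.lhs I J r) s ∼
                             Laurent.coeff termRawRing (RE.rhs I J r) s
    unitary    : ∀ i j r → SD.sum (λ k → B[u] i k S.* B[-u] k j) r ∼
                           (if does (i Fin.≟ j) then S.1# else S.0#) r

  𝓑 : Ring c (c ⊔ ℓ₁)
  𝓑 = record
    { Carrier = Term ; _≈_ = _∼_ ; _+_ = _+_ ; _*_ = _*_ ; -_ = -_ ; 0# = 0# ; 1# = 1#
    ; isRing = record
      { +-isAbelianGroup = record
        { isGroup = record
          { isMonoid = record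
            { isSemigroup = record
              { isMagma = record
                { isEquivalence = record { refl = ∼-refl ; sym = ∼-sym ; trans = ∼-trans }
                ; ∙-cong = +-cong
                }
              ; assoc = +-assoc
              }
            ; identity = +-identityˡ , λ x → ∼-trans (+-comm x 0#) (+-identityˡ x)
            }
          ; inverse = -‿inverseˡ , λ x → ∼-trans (+-comm x (- x)) (-‿inverseˡ x)
          ; ⁻¹-cong = -‿cong
          }
        ; comm = +-comm
        }
      ; *-cong = *-cong
      ; *-assoc = *-assoc
      ; *-identity = *-identityˡ , *-identityʳ
      ; distrib = distribˡ , distribʳ
      }
    }

-- x₀ p₀ x₁ p₁ ⋯ pₙ₋₂ xₙ₋₁
interleavedProduct : ∀ {c ℓ} (R : RawRing c ℓ) {n} →
                     (x p : Fin n → RawRing.Carrier R) → RawRing.Carrier R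
interleavedProduct R {zero}        x p = RawRing.1# R
interleavedProduct R {suc zero}    x p = x zero
interleavedProduct R {suc (suc n)} x p =
  x zero * (p zero * interleavedProduct R (x ∘ suc) (p ∘ suc))
  where open RawRing R

module Expansion {c ℓ₁ ℓ₂} (K : HeytingField c ℓ₁ ℓ₂) (char0 : CharacteristicZero K)
                 (m l : ℕ) where
  open Presentation K m l using (n; scal; B[u]; 𝓑) public

  private
    rawB = Ring.rawRing 𝓑
    module B  = Ring 𝓑
    module BD = RawSemiringDefs (RawRing.rawSemiring rawB)
    module S  = RawRing (Series rawB)
    module SD = RawSemiringDefs S.rawSemiring

  open SeriesOps rawB
  -- Both sides of the expansion live in End(Kⁿ)^{⊗n} ⊗ 𝓑(n,l)[[u⁻¹]], whose
  -- operations are the unqualified ones below.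
  open RawRing (TensorEnd (Series rawB) n n) public
  open RawSemiringDefs rawSemiring using (sum; product) public
  open TensorEndOps (Series rawB) n n public

  fromℕ : ℕ → B.Carrier
  fromℕ k = k BD.× B.1#

  ½ : B.Carrier
  ½ = scal (half K char0)

  B[u-_] : ℕ → Fin n → Fin n → S.Carrier
  B[u- k ] i j = B[u] i j ∘[u⁻¹↦ recip B.1# (B.- fromℕ k) ]

  -- The scalar factor is the expansion of 1/(2u - k - n + 2).
  Π : Fin n → Carrier
  Π k = 1# + - (recip ½ (fromℕ 2 B.- fromℕ (num k) B.- fromℕ n) •
                sum λ i → if does (k Fin.<? i) then P k i else 0#)

  ⟪B₁,…,Bₙ⟫ : Carrier
  ⟪B₁,…,Bₙ⟫ =
    interleavedProduct (TensorEnd (Series rawB) n n) (λ k → B[u- toℕ k ] at k) Π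

  _∈Iₙ : Vec (Fin n) n → Set
  κ ∈Iₙ = ∀ i → i Fin.≤ lookup κ i

  _∈Iₙ? : (κ : Vec (Fin n) n) → Dec (κ ∈Iₙ)
  κ ∈Iₙ? = all? λ i → i Fin.≤? lookup κ i

  ∑[Iₙ] : (Vec (Fin n) n → Carrier) → Carrier
  ∑[Iₙ] f = ∑Vec +-rawMonoid n λ κ → if does (κ ∈Iₙ?) then f κ else 0#

  -- Each factor is the expansion of 1/(-2u + (n - 2 + i)); the inverse of -2 is -½.
  α : Vec (Fin n) n → S.Carrier
  α κ = SD.product λ i →
    if does (i Fin.<? lookup κ i)
    then recip (B.- ½) (fromℕ n B.- fromℕ 2 B.+ fromℕ (num i))
    else S.1#

  Q⁻¹ : Vec (Fin n) n → Carrier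
  Q⁻¹ κ = product λ i → P i (lookup κ i)

  -- (n,kₙ)⋯(i,kᵢ), in which (i,kᵢ) acts first; π ∘ₚ ρ applies π before ρ.
  q[_] : Fin n → Vec (Fin n) n → Perm.Permutation′ n
  q[ i ] κ = Vector.foldr Perm._∘ₚ_ Perm.id λ j →
    if does (i Fin.≤? j) then Perm.transpose j (lookup κ j) else Perm.id

{-# OPTIONS --safe #-}
-- Each Π_k is a sum Σ_{j≥k} c_{kj} P_{kj} with central coefficients (c_{kk} = 1,
-- P_{kk} = 1, and c_{kj} = 1/(n-2u-2+k) for j > k), and Π_n = 1 may be appended
-- to the product. Multiplying out gives one term for each κ ∈ I_n, in which the
-- transpositions are collected on the left by X_s P_{ab} = P_{ab} X_{(a,b)(s)}:
-- the i-th factor passes P_{ik_i}, …, P_{nk_n} and lands in position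
-- (n,k_n)⋯(i,k_i)(i).
module Submission where

open import Defs
open import Algebra.Apartness.Bundles using (HeytingField)
open import Algebra.Bundles using (Ring; Semiring)
open import Algebra.Bundles.Raw using (RawRing)
import Algebra.Construct.Pointwise as Pointwise
import Algebra.Definitions.RawSemiring as RawSemiringDefs
import Algebra.Properties.Monoid.Sum as MonoidSum
import Algebra.Properties.Ring as RingProperties
import Algebra.Properties.AbelianGroup as AbelianGroupProperties
import Algebra.Properties.Semiring.Sum as SemiringSum
open import Data.Bool.Base using (true; false; if_then_else_)
open import Data.Fin.Base as Fin using (Fin; zero; suc; toℕ)
open import Data.Fin.Permutation as Perm using (Permutation′; _⟨$⟩ʳ_)
import Data.Fin.Permutation.Components as PC
import Data.Fin.Properties as Fin
open import Data.Nat.Base as ℕ using (ℕ; zero; suc; s≤s; s≤s⁻¹)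
import Data.Nat.Properties as ℕ
open import Data.Product.Base using (_,_)
open import Data.Sum.Base using (_⊎_; inj₁; inj₂)
open import Data.Vec.Base using (Vec; []; _∷_; lookup; tabulate)
import Data.Vec.Functional as Vector
open import Data.Vec.Properties using (≡-dec; lookup∘tabulate; tabulate∘lookup; tabulate-cong)
open import Function.Base using (_∘_; _$_)
open import Function.Bundles using (mk⇔)
open import Relation.Binary.Definitions using (tri<; tri≈; tri>)
open import Relation.Binary.PropositionalEquality as ≡ using (_≡_; _≢_)
import Relation.Binary.Reasoning.Setoid as SetoidReasoning
open import Relation.Nullary.Decidable using (Dec; yes; no; does; dec-true; dec-false; does-⇔; _⊎-dec_)
open import Relation.Nullary.Negation using (¬_)

-- Conditionals on decided propositions.

module _ {a p} {A : Set a} {P : Set p} {x y : A} where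

  if-yes : (d : Dec P) → P → (if does d then x else y) ≡ x
  if-yes d p = ≡.cong (if_then x else y) (dec-true d p)

  if-no : (d : Dec P) → ¬ P → (if does d then x else y) ≡ y
  if-no d ¬p = ≡.cong (if_then x else y) (dec-false d ¬p)

-- Transpositions and their composites.

transpose-diagonal : ∀ {n} (a p : Fin n) → PC.transpose a a p ≡ p
transpose-diagonal a p with p Fin.≟ a
... | yes p≡a = ≡.sym p≡a
... | no  p≢a rewrite dec-false (p Fin.≟ a) p≢a = ≡.refl

transpose-comm : ∀ {n} (a b p : Fin n) → PC.transpose a b p ≡ PC.transpose b a p
transpose-comm a b p with p Fin.≟ a | p Fin.≟ b
... | yes p≡a | yes p≡b = ≡.trans (≡.sym p≡b) p≡a
... | yes p≡a | no  p≢b rewrite dec-true (p Fin.≟ a) p≡a = ≡.refl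
... | no  p≢a | yes p≡b rewrite dec-true (p Fin.≟ b) p≡b = ≡.refl
... | no  p≢a | no  p≢b rewrite dec-false (p Fin.≟ a) p≢a | dec-false (p Fin.≟ b) p≢b = ≡.refl

transpose-involutive : ∀ {n} (a b p : Fin n) → PC.transpose a b (PC.transpose a b p) ≡ p
transpose-involutive a b p =
  ≡.trans (≡.cong (PC.transpose a b) (transpose-comm a b p)) (PC.transpose-inverse a b)

-- The composite of τ i, τ (i + 1), …, in which τ i acts first.
composeFrom : ∀ {h k} → Fin h → (Fin h → Permutation′ k) → Permutation′ k
composeFrom i τ = Vector.foldr Perm._∘ₚ_ Perm.id λ j → if does (i Fin.≤? j) then τ j else Perm.id

-- The composites are compared only after evaluation at `s`; with families that agree index by
-- index, equating the composites themselves would require function extensionality.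
foldr-∘ₚ-cong : ∀ {h k} {σ τ : Fin h → Permutation′ k} → (∀ j → σ j ≡ τ j) → ∀ s →
  Vector.foldr Perm._∘ₚ_ Perm.id σ ⟨$⟩ʳ s ≡ Vector.foldr Perm._∘ₚ_ Perm.id τ ⟨$⟩ʳ s
foldr-∘ₚ-cong {zero}              σ≡τ s = ≡.refl
foldr-∘ₚ-cong {suc h} {τ = τ} σ≡τ s rewrite σ≡τ zero =
  foldr-∘ₚ-cong (σ≡τ ∘ suc) (τ zero ⟨$⟩ʳ s)

-- The test `suc i ≤ zero` computes to false, so the factor at `zero` is the identity, and the tests
-- `suc i ≤ suc j` and `i ≤ j` have the same truth value. This drives the induction in
-- `product-at-P`.
composeFrom-suc : ∀ {h k} (i : Fin h) (τ : Fin (suc h) → Permutation′ k) s →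
                  composeFrom (suc i) τ ⟨$⟩ʳ s ≡ composeFrom i (τ ∘ suc) ⟨$⟩ʳ s
composeFrom-suc i τ = foldr-∘ₚ-cong λ j → ≡.cong (if_then τ (suc j) else Perm.id) $
  does-⇔ (mk⇔ s≤s⁻¹ s≤s) (suc i Fin.≤? suc j) (i Fin.≤? j)

-- Finite sums and products over semirings and rings.

module _ {c ℓ} (S : Semiring c ℓ) where
  open Semiring S hiding (zero)
  open SemiringSum S
  open RawSemiringDefs rawSemiring using (product)
  open SetoidReasoning setoid

  sum-zero : ∀ {n} (f : Fin n → Carrier) → (∀ i → f i ≈ 0#) → sum f ≈ 0#
  sum-zero {n} f f≈0 = trans (sum-cong-≋ f≈0) (sum-replicate-zero n)

  sum-single : ∀ {n} (f : Fin n → Carrier) i → (∀ j → j ≢ i → f j ≈ 0#) → sum f ≈ f i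
  sum-single f zero f≈0 =
    trans (+-congˡ (sum-zero (f ∘ suc) λ j → f≈0 (suc j) λ ())) (+-identityʳ _)
  sum-single f (suc i) f≈0 =
    trans (+-cong (f≈0 zero λ ())
                  (sum-single (f ∘ suc) i λ j j≢i → f≈0 (suc j) (j≢i ∘ Fin.suc-injective)))
          (+-identityˡ _)

  module _ {N : ℕ} where

    ∑ : ∀ k → (Vec (Fin N) k → Carrier) → Carrier
    ∑ = ∑Vec +-rawMonoid

    ∑-cong : ∀ k {f g : Vec (Fin N) k → Carrier} → (∀ I → f I ≈ g I) → ∑ k f ≈ ∑ k g
    ∑-cong zero    f≈g = f≈g []
    ∑-cong (suc k) f≈g = sum-cong-≋ λ i → ∑-cong k (f≈g ∘ (i ∷_))

    ∑-zero : ∀ k (f : Vec (Fin N) k → Carrier) → (∀ I → f I ≈ 0#) → ∑ k f ≈ 0#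
    ∑-zero zero    f f≈0 = f≈0 []
    ∑-zero (suc k) f f≈0 = sum-zero {N} _ λ i → ∑-zero k (f ∘ (i ∷_)) (f≈0 ∘ (i ∷_))

    ∑-single : ∀ k (f : Vec (Fin N) k → Carrier) I → (∀ J → J ≢ I → f J ≈ 0#) → ∑ k f ≈ f I
    ∑-single zero    f []      f≈0 = refl
    ∑-single (suc k) f (i ∷ I) f≈0 = trans
      (sum-single {N} _ i λ j j≢i →
        ∑-zero k _ λ J → f≈0 (j ∷ J) λ { ≡.refl → j≢i ≡.refl })
      (∑-single k (f ∘ (i ∷_)) I λ J J≢I → f≈0 (i ∷ J) λ { ≡.refl → J≢I ≡.refl })

    ∑-+ : ∀ k (f g : Vec (Fin N) k → Carrier) → ∑ k (λ I → f I + g I) ≈ ∑ k f + ∑ k g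
    ∑-+ zero    f g = refl
    ∑-+ (suc k) f g = trans (sum-cong-≋ λ i → ∑-+ k (f ∘ (i ∷_)) (g ∘ (i ∷_)))
                            (∑-distrib-+ {N} _ _)

    *-distribˡ-∑ : ∀ k x (f : Vec (Fin N) k → Carrier) → x * ∑ k f ≈ ∑ k (λ I → x * f I)
    *-distribˡ-∑ zero    x f = refl
    *-distribˡ-∑ (suc k) x f = trans (*-distribˡ-sum {N} x _)
                                     (sum-cong-≋ λ i → *-distribˡ-∑ k x (f ∘ (i ∷_)))

    *-distribʳ-∑ : ∀ k x (f : Vec (Fin N) k → Carrier) → ∑ k f * x ≈ ∑ k (λ I → f I * x)
    *-distribʳ-∑ zero    x f = refl
    *-distribʳ-∑ (suc k) x f = trans (*-distribʳ-sum {N} x _)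
                                     (sum-cong-≋ λ i → *-distribʳ-∑ k x (f ∘ (i ∷_)))

    sum-∑-comm : ∀ {n} k (f : Fin n → Vec (Fin N) k → Carrier) →
                 sum (λ i → ∑ k (f i)) ≈ ∑ k (λ I → sum λ i → f i I)
    sum-∑-comm zero    f = refl
    sum-∑-comm {n} (suc k) f = trans (∑-comm {n} {N} _)
                                 (sum-cong-≋ λ j → sum-∑-comm k λ i → f i ∘ (j ∷_))

    ∑-∑-comm : ∀ j k (f : Vec (Fin N) j → Vec (Fin N) k → Carrier) →
               ∑ j (λ I → ∑ k (f I)) ≈ ∑ k (λ J → ∑ j λ I → f I J)
    ∑-∑-comm zero    k f = refl
    ∑-∑-comm (suc j) k f = trans (sum-cong-≋ λ i → ∑-∑-comm j k (f ∘ (i ∷_)))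
                                 (sum-∑-comm {N} k _)

    -- Multiplying out: a tuple `κ` records which summand is taken from each factor, and the order
    -- of the factors is kept. All tuples occur here, including those outside I_n.
    product-sum : ∀ k (f : Fin k → Fin N → Carrier) →
                  product (λ i → sum (f i)) ≈ ∑ k (λ κ → product λ i → f i (lookup κ i))
    product-sum zero    f = refl
    product-sum (suc k) f = begin
      sum (f zero) * product (λ i → sum (f (suc i)))
        ≈⟨ *-distribʳ-sum {N} _ (f zero) ⟩
      sum (λ j → f zero j * product (λ i → sum (f (suc i))))
        ≈⟨ sum-cong-≋ (λ j → trans (*-congˡ (product-sum k (f ∘ suc)))
                                   (*-distribˡ-∑ k (f zero j) _)) ⟩
      ∑ (suc k) (λ κ → product λ i → f i (lookup κ i)) ∎

  product-zero : ∀ {n} (f : Fin n → Carrier) i → f i ≈ 0# → product f ≈ 0#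
  product-zero f zero    f≈0 = trans (*-congʳ f≈0) (zeroˡ _)
  product-zero f (suc i) f≈0 = trans (*-congˡ (product-zero (f ∘ suc) i f≈0)) (zeroʳ _)

  product-cong : ∀ {n} {f g : Fin n → Carrier} → (∀ i → f i ≈ g i) → product f ≈ product g
  product-cong = MonoidSum.sum-cong-≋ *-monoid

module _ {c ℓ} (R : Ring c ℓ) where
  open Ring R hiding (zero)
  open RawSemiringDefs (RawRing.rawSemiring rawRing) using (product)
  open SetoidReasoning setoid

  -- An interleaved product has one `p` fewer than it has `x`. Appending a last `p` equal to 1 gives
  -- all factors the same shape, as `product-sum` requires.
  interleavedProduct-last : ∀ {n} (x p : Fin n → Carrier) →
                            (∀ i → suc (toℕ i) ≡ n → p i ≈ 1#) →
                            interleavedProduct rawRing x p ≈ product (λ i → x i * p i)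
  interleavedProduct-last {zero}        x p p≈1 = refl
  interleavedProduct-last {suc zero}    x p p≈1 = sym $
    trans (*-identityʳ _) (trans (*-congˡ (p≈1 zero ≡.refl)) (*-identityʳ _))
  interleavedProduct-last {suc (suc n)} x p p≈1 =
    trans (*-congˡ (*-congˡ (interleavedProduct-last (x ∘ suc) (p ∘ suc)
                              λ i e → p≈1 (suc i) (≡.cong suc e))))
          (sym (*-assoc _ _ _))

-- Central elements of a ring.

module Centre {c ℓ} (R : Ring c ℓ) where
  open Ring R hiding (zero)
  open RingProperties R
  open RawSemiringDefs (RawRing.rawSemiring rawRing) using (product; _^_) renaming (_×_ to _×ℕ_)
  open SetoidReasoning setoid

  Central : Carrier → Set _
  Central z = ∀ x → z * x ≈ x * z

  central-0 : Central 0#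
  central-0 x = trans (zeroˡ x) (sym (zeroʳ x))

  central-1 : Central 1#
  central-1 x = trans (*-identityˡ x) (sym (*-identityʳ x))

  central-+ : ∀ {y z} → Central y → Central z → Central (y + z)
  central-+ cy cz x = trans (distribʳ _ _ _) (trans (+-cong (cy x) (cz x)) (sym (distribˡ _ _ _)))

  central-* : ∀ {y z} → Central y → Central z → Central (y * z)
  central-* {y} {z} cy cz x = begin
    (y * z) * x  ≈⟨ *-assoc _ _ _ ⟩
    y * (z * x)  ≈⟨ *-congˡ (cz x) ⟩
    y * (x * z)  ≈⟨ *-assoc _ _ _ ⟨
    (y * x) * z  ≈⟨ *-congʳ (cy x) ⟩
    (x * y) * z  ≈⟨ *-assoc _ _ _ ⟩
    x * (y * z)  ∎

  central-neg : ∀ {z} → Central z → Central (- z)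
  central-neg cz x =
    trans (sym (-‿distribˡ-* _ _)) (trans (-‿cong (cz x)) (-‿distribʳ-* _ _))

  central-^ : ∀ {z} n → Central z → Central (z ^ n)
  central-^ zero    cz = central-1
  central-^ (suc n) cz = central-* cz (central-^ n cz)

  central-× : ∀ {z} n → Central z → Central (n ×ℕ z)
  central-× zero    cz = central-0
  central-× (suc n) cz = central-+ cz (central-× n cz)

  central-product : ∀ {n} (w : Fin n → Carrier) → (∀ i → Central (w i)) → Central (product w)
  central-product {zero}  w cw = central-1
  central-product {suc n} w cw = central-* (cw zero) (central-product (w ∘ suc) (cw ∘ suc))

-- The ring of formal power series and the expansions of reciprocals.

module SeriesProperties {c ℓ} (R : Ring c ℓ) where
  open Ring R hiding (zero)
  open RingProperties R
  open SemiringSum semiring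
  open RawSemiringDefs (RawRing.rawSemiring rawRing) using (_^_)
  open Centre R
  open SeriesOps rawRing
  open SetoidReasoning setoid
  private
    module S = RawRing (Series rawRing)

    tail : S.Carrier → S.Carrier
    tail f r = f (suc r)

    terms : S.Carrier → S.Carrier → ∀ r → Fin (suc r) → Carrier
    terms f g r s = f (toℕ s) * g (r ℕ.∸ toℕ s)

  -- The recursion (f g)(r+1) = f₀ g(r+1) + (tail f · g)(r) holds definitionally;
  -- this is its mirror image.
  *-sucʳ : ∀ f g r → (f S.* g) (suc r) ≈ (f S.* tail g) r + f (suc r) * g 0
  *-sucʳ f g zero    = trans (+-congˡ (+-identityʳ _)) (+-congʳ (sym (+-identityʳ _)))
  *-sucʳ f g (suc r) = trans (+-congˡ (*-sucʳ (tail f) g r)) (sym (+-assoc _ _ _))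

  -- The two recursions peel the convolution from opposite ends: the definitional one splits off the
  -- term with f₀ on the left, `*-sucʳ` the one with f₀ on the right. No reversal of the summation
  -- index is needed.
  central-coeffs : ∀ f → (∀ r → Central (f r)) → ∀ g r → (f S.* g) r ≈ (g S.* f) r
  central-coeffs f cf g zero    = +-congʳ (cf 0 (g 0))
  central-coeffs f cf g (suc r) = begin
    f 0 * g (suc r) + (tail f S.* g) r  ≈⟨ +-cong (cf 0 _) (central-coeffs (tail f) (cf ∘ suc) g r) ⟩
    g (suc r) * f 0 + (g S.* tail f) r  ≈⟨ +-comm _ _ ⟩
    (g S.* tail f) r + g (suc r) * f 0  ≈⟨ *-sucʳ g f r ⟨
    (g S.* f) (suc r)                   ∎

  series-distribˡ : ∀ f g h r → (f S.* (g S.+ h)) r ≈ ((f S.* g) S.+ (f S.* h)) r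
  series-distribˡ f g h r =
    trans (sum-cong-≋ {suc r} {terms f (g S.+ h) r} λ s → distribˡ (f (toℕ s)) _ _)
          (∑-distrib-+ (terms f g r) (terms f h r))

  series-distribʳ : ∀ f g h r → ((g S.+ h) S.* f) r ≈ ((g S.* f) S.+ (h S.* f)) r
  series-distribʳ f g h r =
    trans (sum-cong-≋ {suc r} {terms (g S.+ h) f r} λ s → distribʳ (f (r ℕ.∸ toℕ s)) _ _)
          (∑-distrib-+ (terms g f r) (terms h f r))

  series-*-cong : ∀ {f f′ g g′} → f S.≈ f′ → g S.≈ g′ → (f S.* g) S.≈ (f′ S.* g′)
  series-*-cong f≈f′ g≈g′ r =
    sum-cong-≋ {suc r} λ s → *-cong (f≈f′ (toℕ s)) (g≈g′ (r ℕ.∸ toℕ s))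

  *-scale : ∀ a f g r → ((λ t → a * f t) S.* g) r ≈ a * (f S.* g) r
  *-scale a f g r =
    trans (sum-cong-≋ {suc r} λ s → *-assoc a (f (toℕ s)) (g (r ℕ.∸ toℕ s)))
          (sym (*-distribˡ-sum a (terms f g r)))

  -- Induction on the degree. The tail of `f S.* g` is, by computation, f₀ times the tail of `g`,
  -- plus `tail f S.* g`; the first part is handled by `*-scale`, the second by the induction
  -- hypothesis.
  series-*-assoc : ∀ f g h r → ((f S.* g) S.* h) r ≈ (f S.* (g S.* h)) r
  series-*-assoc f g h zero = +-congʳ $ begin
    (f 0 * g 0 + 0#) * h 0  ≈⟨ *-congʳ (+-identityʳ _) ⟩
    (f 0 * g 0) * h 0       ≈⟨ *-assoc _ _ _ ⟩
    f 0 * (g 0 * h 0)       ≈⟨ *-congˡ (+-identityʳ _) ⟨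
    f 0 * (g 0 * h 0 + 0#)  ∎
  series-*-assoc f g h (suc r) = begin
    (f 0 * g 0 + 0#) * h (suc r) + (tail (f S.* g) S.* h) r
      ≈⟨ +-cong (trans (*-congʳ (+-identityʳ _)) (*-assoc _ _ _))
                (series-distribʳ h (λ t → f 0 * tail g t) (tail f S.* g) r) ⟩
    f 0 * (g 0 * h (suc r)) + (((λ t → f 0 * tail g t) S.* h) r + ((tail f S.* g) S.* h) r)
      ≈⟨ +-congˡ (+-cong (*-scale (f 0) (tail g) h r) (series-*-assoc (tail f) g h r)) ⟩
    f 0 * (g 0 * h (suc r)) + (f 0 * (tail g S.* h) r + (tail f S.* (g S.* h)) r)
      ≈⟨ +-assoc _ _ _ ⟨
    (f 0 * (g 0 * h (suc r)) + f 0 * (tail g S.* h) r) + (tail f S.* (g S.* h)) r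
      ≈⟨ +-congʳ (distribˡ _ _ _) ⟨
    f 0 * (g S.* h) (suc r) + (tail f S.* (g S.* h)) r ∎

  series-*-identityˡ : ∀ f r → (S.1# S.* f) r ≈ f r
  series-*-identityˡ f zero    = trans (+-identityʳ _) (*-identityˡ _)
  series-*-identityˡ f (suc r) =
    trans (+-cong (*-identityˡ _) (sum-zero semiring {suc r} _ λ s → zeroˡ (f (r ℕ.∸ toℕ s)))) (+-identityʳ _)

  series-*-identityʳ : ∀ f r → (f S.* S.1#) r ≈ f r
  -- The coefficients of the unit are central, so the right law reduces to the left one.
  series-*-identityʳ f r = trans (sym (central-coeffs S.1# central f r)) (series-*-identityˡ f r)
    where
    central : ∀ r → Central (S.1# r)
    central zero    = central-1
    central (suc r) = central-0

  seriesRing : Ring c ℓ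
  seriesRing = record
    { Carrier = S.Carrier ; _≈_ = S._≈_ ; _+_ = S._+_ ; _*_ = S._*_ ; -_ = S.-_ ; 0# = S.0# ; 1# = S.1#
    ; isRing = record
      { +-isAbelianGroup = Pointwise.isAbelianGroup ℕ +-isAbelianGroup
      ; *-cong = series-*-cong
      ; *-assoc = series-*-assoc
      ; *-identity = series-*-identityˡ , series-*-identityʳ
      ; distrib = series-distribˡ , series-distribʳ
      }
    }

  central-recip : ∀ {a b} → Central a → Central b → ∀ r → Central (recip a b r)
  central-recip ca cb zero    = central-0
  central-recip ca cb (suc r) =
    central-* (central-^ r (central-neg cb)) (central-^ (suc r) ca)

  ^-cong : ∀ {x y} r → x ≈ y → x ^ r ≈ y ^ r
  ^-cong zero    x≈y = refl
  ^-cong (suc r) x≈y = *-cong x≈y (^-cong r x≈y)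

  recip-congʳ : ∀ {a b b′} → b ≈ b′ → recip a b S.≈ recip a b′
  recip-congʳ b≈b′ zero    = refl
  recip-congʳ b≈b′ (suc r) = *-congʳ (^-cong r (-‿cong b≈b′))

  -- Multiplication by (-1)ʳ, written as iterated negation so that signs move through noncommutative
  -- products by the sign rules alone.
  negate^ : ℕ → Carrier → Carrier
  negate^ zero    x = x
  negate^ (suc r) x = - negate^ r x

  ^-negˡ : ∀ x z r → (- x) ^ r * z ≈ x ^ r * negate^ r z
  ^-negˡ x z zero    = refl
  ^-negˡ x z (suc r) = begin
    (- x * (- x) ^ r) * z           ≈⟨ *-assoc _ _ _ ⟩
    - x * ((- x) ^ r * z)           ≈⟨ *-congˡ (^-negˡ x z r) ⟩
    - x * (x ^ r * negate^ r z)     ≈⟨ -‿distribˡ-* _ _ ⟨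
    - (x * (x ^ r * negate^ r z))   ≈⟨ -‿cong (*-assoc _ _ _) ⟨
    - ((x * x ^ r) * negate^ r z)   ≈⟨ -‿distribʳ-* _ _ ⟩
    (x * x ^ r) * - negate^ r z     ∎

  *-negate^ : ∀ x y r → x * negate^ r y ≈ negate^ r (x * y)
  *-negate^ x y zero    = refl
  *-negate^ x y (suc r) = trans (sym (-‿distribʳ-* _ _)) (-‿cong (*-negate^ x y r))

  ^-neg : ∀ x r → (- x) ^ r ≈ negate^ r (x ^ r)
  ^-neg x r = begin
    (- x) ^ r              ≈⟨ *-identityʳ _ ⟨
    (- x) ^ r * 1#         ≈⟨ ^-negˡ x 1# r ⟩
    x ^ r * negate^ r 1#   ≈⟨ *-negate^ _ _ r ⟩
    negate^ r (x ^ r * 1#) ≈⟨ negate^-cong r (*-identityʳ _) ⟩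
    negate^ r (x ^ r)      ∎
    where
    negate^-cong : ∀ r {x y} → x ≈ y → negate^ r x ≈ negate^ r y
    negate^-cong zero    x≈y = x≈y
    negate^-cong (suc r) x≈y = -‿cong (negate^-cong r x≈y)

  -- In degree r + 1 the power of `- a` yields r + 1 signs: one is taken out in front, and the other
  -- r are absorbed into the power of `- b`.
  recip-neg : ∀ a b → recip (- a) b S.≈ S.- recip a (- b)
  recip-neg a b zero    = sym -0#≈0#
  recip-neg a b (suc r) = begin
    (- b) ^ r * (- a) ^ suc r            ≈⟨ *-congˡ (^-neg a (suc r)) ⟩
    (- b) ^ r * - negate^ r (a ^ suc r)  ≈⟨ -‿distribʳ-* _ _ ⟨
    - ((- b) ^ r * negate^ r (a ^ suc r)) ≈⟨ -‿cong (^-negˡ (- b) _ r) ⟨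
    - ((- - b) ^ r * a ^ suc r)          ∎

-- The ring of tensor endomorphisms and its scalars.

module TensorEndProperties {c ℓ} (A : Ring c ℓ) (N k : ℕ) where
  open Ring A hiding (zero)
  open RingProperties A
  open Centre A
  private module E = RawRing (TensorEnd rawRing N k)
  open TensorEndOps rawRing N k

  private
    Index : Set
    Index = Vec (Fin N) k

    _≟ᵛ_ : (I J : Index) → Dec (I ≡ J)
    _≟ᵛ_ = ≡-dec Fin._≟_

  tensorEnd-*-assoc : ∀ X Y Z → ((X E.* Y) E.* Z) E.≈ (X E.* (Y E.* Z))
  tensorEnd-*-assoc X Y Z I J = begin
    ∑ semiring k (λ L → ∑ semiring k (λ K → X I K * Y K L) * Z L J)
      ≈⟨ ∑-cong semiring k (λ L → *-distribʳ-∑ semiring k _ _) ⟩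
    ∑ semiring k (λ L → ∑ semiring k (λ K → (X I K * Y K L) * Z L J))
      ≈⟨ ∑-∑-comm semiring k k _ ⟩
    ∑ semiring k (λ K → ∑ semiring k (λ L → (X I K * Y K L) * Z L J))
      ≈⟨ ∑-cong semiring k (λ K → trans (∑-cong semiring k (λ L → *-assoc _ _ _))
                                        (sym (*-distribˡ-∑ semiring k _ _))) ⟩
    ∑ semiring k (λ K → X I K * ∑ semiring k (λ L → Y K L * Z L J)) ∎
    where open SetoidReasoning setoid

  -- Serves the identity and every `P a b` alike: each of their rows and columns has a single entry
  -- 1 and zeros elsewhere.
  indicator-*ˡ : ∀ {f g : Index → Carrier} I → f I ≈ 1# → (∀ J → J ≢ I → f J ≈ 0#) →
                 ∑ semiring k (λ J → f J * g J) ≈ g I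
  indicator-*ˡ I f≈1 f≈0 =
    trans (∑-single semiring k _ I λ J J≢I → trans (*-congʳ (f≈0 J J≢I)) (zeroˡ _))
          (trans (*-congʳ f≈1) (*-identityˡ _))

  indicator-*ʳ : ∀ {f g : Index → Carrier} I → f I ≈ 1# → (∀ J → J ≢ I → f J ≈ 0#) →
                 ∑ semiring k (λ J → g J * f J) ≈ g I
  indicator-*ʳ I f≈1 f≈0 =
    trans (∑-single semiring k _ I λ J J≢I → trans (*-congˡ (f≈0 J J≢I)) (zeroʳ _))
          (trans (*-congˡ f≈1) (*-identityʳ _))

  tensorEndRing : Ring c ℓ
  tensorEndRing = record
    { Carrier = E.Carrier ; _≈_ = E._≈_ ; _+_ = E._+_ ; _*_ = E._*_ ; -_ = E.-_ ; 0# = E.0# ; 1# = E.1#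
    ; isRing = record
      { +-isAbelianGroup =
          Pointwise.isAbelianGroup Index (Pointwise.isAbelianGroup Index +-isAbelianGroup)
      ; *-cong = λ X≈X′ Y≈Y′ I J → ∑-cong semiring k λ K → *-cong (X≈X′ I K) (Y≈Y′ K J)
      ; *-assoc = tensorEnd-*-assoc
      ; *-identity =
          (λ X I J → indicator-*ˡ I (reflexive (if-yes (I ≟ᵛ I) ≡.refl))
                                    (λ K K≢I → reflexive (if-no (I ≟ᵛ K) (K≢I ∘ ≡.sym)))) ,
          (λ X I J → indicator-*ʳ J (reflexive (if-yes (J ≟ᵛ J) ≡.refl))
                                    (λ K K≢J → reflexive (if-no (K ≟ᵛ J) K≢J)))
      ; distrib =
          (λ X Y Z I J → trans (∑-cong semiring k λ K → distribˡ _ _ _) (∑-+ semiring k _ _)) ,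
          (λ X Y Z I J → trans (∑-cong semiring k λ K → distribʳ _ _ _) (∑-+ semiring k _ _))
      }
    }

  private module ER = Ring tensorEndRing
  open RawSemiringDefs E.rawSemiring using () renaming (sum to sumᴱ; product to productᴱ)
  open RawSemiringDefs (RawRing.rawSemiring rawRing) using (product)

  •-cong : ∀ {a b X Y} → a ≈ b → X E.≈ Y → (a • X) E.≈ (b • Y)
  •-cong a≈b X≈Y I J = *-cong a≈b (X≈Y I J)

  •-*-assoc : ∀ a X Y → ((a • X) E.* Y) E.≈ (a • (X E.* Y))
  •-*-assoc a X Y I J = trans (∑-cong semiring k λ K → *-assoc _ _ _)
                              (sym (*-distribˡ-∑ semiring k _ _))

  *-•-comm : ∀ {a} → Central a → ∀ X Y → (X E.* (a • Y)) E.≈ (a • (X E.* Y))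
  *-•-comm {a} ca X Y I J =
    trans (∑-cong semiring k λ K →
             trans (sym (*-assoc _ _ _)) (trans (*-congʳ (sym (ca _))) (*-assoc _ _ _)))
          (sym (*-distribˡ-∑ semiring k _ _))

  neg-•-sum : ∀ {n} a (X : Fin n → E.Carrier) → (E.- (a • sumᴱ X)) E.≈ sumᴱ (λ i → (- a) • X i)
  neg-•-sum {zero}  a X I J = trans (-‿cong (zeroʳ _)) -0#≈0#
  neg-•-sum {suc n} a X I J =
    trans (-‿distribˡ-* _ _) (trans (distribˡ _ _ _)
      (+-congˡ (trans (sym (-‿distribˡ-* _ _)) (neg-•-sum a (X ∘ suc) I J))))

  -- By centrality each weight passes the matrices to its left, and the weights gather in front in
  -- their original order.
  product-• : ∀ {n} (w : Fin n → Carrier) → (∀ i → Central (w i)) → (X Y : Fin n → E.Carrier) →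
              productᴱ (λ i → X i E.* (w i • Y i)) E.≈ (product w • productᴱ (λ i → X i E.* Y i))
  product-• {zero}  w cw X Y I J = sym (*-identityˡ _)
  product-• {suc n} w cw X Y = begin
    (X₀ E.* (w₀ • Y₀)) E.* productᴱ (λ i → X (suc i) E.* (w (suc i) • Y (suc i)))
      ≈⟨ ER.*-cong (*-•-comm (cw zero) X₀ Y₀) (product-• (w ∘ suc) (cw ∘ suc) (X ∘ suc) (Y ∘ suc)) ⟩
    (w₀ • (X₀ E.* Y₀)) E.* (w′ • Z)
      ≈⟨ •-*-assoc w₀ (X₀ E.* Y₀) (w′ • Z) ⟩
    (w₀ • ((X₀ E.* Y₀) E.* (w′ • Z)))
      ≈⟨ •-cong refl (*-•-comm (central-product (w ∘ suc) (cw ∘ suc)) (X₀ E.* Y₀) Z) ⟩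
    (w₀ • (w′ • ((X₀ E.* Y₀) E.* Z)))
      ≈⟨ (λ I J → sym (*-assoc _ _ _)) ⟩
    ((w₀ * w′) • ((X₀ E.* Y₀) E.* Z)) ∎
    where
    open SetoidReasoning ER.setoid
    X₀ Y₀ Z : E.Carrier
    X₀ = X zero
    Y₀ = Y zero
    Z  = productᴱ (λ i → X (suc i) E.* Y (suc i))
    w₀ w′ : Carrier
    w₀ = w zero
    w′ = product (w ∘ suc)

  -- Permutation operators on tensor indices, and the factors Π_a.

  -- The action of `P a b` on basis tensors: `swap a b J` is the J′ in the definition of `P`.
  swap : Fin k → Fin k → Index → Index
  swap a b J = tabulate λ p → lookup J (PC.transpose a b p)

  lookup-swap : ∀ a b J p → lookup (swap a b J) p ≡ lookup J (PC.transpose a b p)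
  lookup-swap a b J p = lookup∘tabulate (λ p → lookup J (PC.transpose a b p)) p

  swap-involutive : ∀ a b J → swap a b (swap a b J) ≡ J
  swap-involutive a b J = ≡.trans
    (tabulate-cong λ p → ≡.trans (lookup-swap a b J _)
                                 (≡.cong (lookup J) (transpose-involutive a b p)))
    (tabulate∘lookup J)

  -- Row `I` of `P a b` has its 1 in the column `K` with `swap a b K ≡ I`; the involution solves
  -- this for `K`. In `*-P` the position of the 1 can be read off directly.
  P-* : ∀ a b X I J → (P a b E.* X) I J ≈ X (swap a b I) J
  P-* a b X I J = indicator-*ˡ (swap a b I)
    (reflexive (if-yes (I ≟ᵛ _) (≡.sym (swap-involutive a b I))))
    λ K K≢ → reflexive $ if-no (I ≟ᵛ _) λ I≡ →
      K≢ (≡.trans (≡.sym (swap-involutive a b K)) (≡.cong (swap a b) (≡.sym I≡)))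

  *-P : ∀ a b X I J → (X E.* P a b) I J ≈ X I (swap a b J)
  *-P a b X I J = indicator-*ʳ (swap a b J)
    (reflexive (if-yes (swap a b J ≟ᵛ swap a b J) ≡.refl))
    λ K K≢ → reflexive $ if-no (K ≟ᵛ _) K≢

  P-diagonal : ∀ a → P a a E.≈ E.1#
  P-diagonal a I J = reflexive $ ≡.cong (λ J′ → if does (I ≟ᵛ J′) then 1# else 0#) $
    ≡.trans (tabulate-cong λ p → ≡.cong (lookup J) (transpose-diagonal a p)) (tabulate∘lookup J)

  -- On the left the transposition permutes the column index, on the right the row index.
  -- Substituting `τ t` for `t` turns one agreement condition into the other, and the exempt
  -- position `s` becomes `τ s`.
  at-*-P : ∀ X s a b →
           ((X at s) E.* P a b) E.≈ (P a b E.* (X at (Perm.transpose a b ⟨$⟩ʳ s)))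
  at-*-P X s a b I J = begin
    ((X at s) E.* P a b) I J           ≈⟨ *-P a b (X at s) I J ⟩
    -- Both sides are conditionals; their tests and their values are matched separately.
    (X at s) I (swap a b J)            ≡⟨ ≡.cong₂ (if_then_else 0#) agree entries ⟩
    (X at τ s) (swap a b I) J          ≈⟨ P-* a b (X at τ s) I J ⟨
    (P a b E.* (X at τ s)) I J         ∎
    where
    open SetoidReasoning setoid
    τ : Fin k → Fin k
    τ = PC.transpose a b

    agree : does (Fin.all? λ t → (t Fin.≟ s) ⊎-dec (lookup I t Fin.≟ lookup (swap a b J) t)) ≡
            does (Fin.all? λ t → (t Fin.≟ τ s) ⊎-dec (lookup (swap a b I) t Fin.≟ lookup J t))
    agree = does-⇔ (mk⇔ to from) (Fin.all? _) (Fin.all? _)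
      where
      to : (∀ t → t ≡ s ⊎ lookup I t ≡ lookup (swap a b J) t) →
           ∀ t → t ≡ τ s ⊎ lookup (swap a b I) t ≡ lookup J t
      to h t with h (τ t)
      ... | inj₁ τt≡s = inj₁ (≡.trans (≡.sym (transpose-involutive a b t)) (≡.cong τ τt≡s))
      ... | inj₂ eq   = inj₂ (≡.trans (lookup-swap a b I t) (≡.trans eq
              (≡.trans (lookup-swap a b J (τ t)) (≡.cong (lookup J) (transpose-involutive a b t)))))
      from : (∀ t → t ≡ τ s ⊎ lookup (swap a b I) t ≡ lookup J t) →
             ∀ t → t ≡ s ⊎ lookup I t ≡ lookup (swap a b J) t
      from h t with h (τ t)
      ... | inj₁ τt≡τs = inj₁ (≡.trans (≡.sym (transpose-involutive a b t))
                                 (≡.trans (≡.cong τ τt≡τs) (transpose-involutive a b s)))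
      ... | inj₂ eq    = inj₂ (≡.trans (≡.cong (lookup I) (≡.sym (transpose-involutive a b t)))
              (≡.trans (≡.sym (lookup-swap a b I (τ t)))
                (≡.trans eq (≡.sym (lookup-swap a b J t)))))

    entries : X (lookup I s) (lookup (swap a b J) s) ≡ X (lookup (swap a b I) (τ s)) (lookup J (τ s))
    entries = ≡.cong₂ X
      (≡.sym (≡.trans (lookup-swap a b I (τ s)) (≡.cong (lookup I) (transpose-involutive a b s))))
      (lookup-swap a b J s)

  -- The leftmost `P` is met first, so its transposition is the first to act on `s`, which is the
  -- order of composition in `_∘ₚ_`.
  at-*-product-P : ∀ {h} X s (a b : Fin h → Fin k) →
    ((X at s) E.* productᴱ (λ j → P (a j) (b j))) E.≈
    (productᴱ (λ j → P (a j) (b j)) E.*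
      (X at (Vector.foldr Perm._∘ₚ_ Perm.id (λ j → Perm.transpose (a j) (b j)) ⟨$⟩ʳ s)))
  at-*-product-P {zero}  X s a b = ER.trans (ER.*-identityʳ (X at s)) (ER.sym (ER.*-identityˡ (X at s)))
  at-*-product-P {suc h} X s a b = begin
    (X at s) E.* (P₀ E.* Q)              ≈⟨ ER.*-assoc (X at s) P₀ Q ⟨
    ((X at s) E.* P₀) E.* Q              ≈⟨ ER.*-congʳ {Q} (at-*-P X s (a zero) (b zero)) ⟩
    (P₀ E.* (X at τ s)) E.* Q            ≈⟨ ER.*-assoc P₀ (X at τ s) Q ⟩
    P₀ E.* ((X at τ s) E.* Q)            ≈⟨ ER.*-congˡ {P₀} (at-*-product-P X (τ s) (a ∘ suc) (b ∘ suc)) ⟩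
    P₀ E.* (Q E.* (X at (ρ ⟨$⟩ʳ τ s)))   ≈⟨ ER.*-assoc P₀ Q (X at (ρ ⟨$⟩ʳ τ s)) ⟨
    (P₀ E.* Q) E.* (X at (ρ ⟨$⟩ʳ τ s))   ∎
    where
    open SetoidReasoning ER.setoid
    P₀ Q : E.Carrier
    P₀ = P (a zero) (b zero)
    Q  = productᴱ λ j → P (a (suc j)) (b (suc j))
    τ : Fin k → Fin k
    τ = PC.transpose (a zero) (b zero)
    ρ : Permutation′ k
    ρ = Vector.foldr Perm._∘ₚ_ Perm.id λ j → Perm.transpose (a (suc j)) (b (suc j))

  -- The tail is rearranged first, with its transpositions in front; then the first matrix passes
  -- its own `P₀` and all of those. Hence the i-th matrix meets exactly the transpositions from
  -- index i on.
  product-at-P : ∀ {h} (X : Fin h → Fin N → Fin N → Carrier) (s a b : Fin h → Fin k) →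
    productᴱ (λ i → (X i at s i) E.* P (a i) (b i)) E.≈
    (productᴱ (λ i → P (a i) (b i)) E.*
      productᴱ (λ i → X i at (composeFrom i (λ j → Perm.transpose (a j) (b j)) ⟨$⟩ʳ s i)))
  product-at-P {zero}  X s a b = ER.sym (ER.*-identityˡ E.1#)
  product-at-P {suc h} X s a b = begin
    (B₀ E.* P₀) E.* productᴱ (λ i → (X (suc i) at s (suc i)) E.* P (a (suc i)) (b (suc i)))
      ≈⟨ ER.*-congˡ {B₀ E.* P₀} (product-at-P (X ∘ suc) (s ∘ suc) (a ∘ suc) (b ∘ suc)) ⟩
    (B₀ E.* P₀) E.* (Q E.* Z′)     ≈⟨ ER.*-assoc (B₀ E.* P₀) Q Z′ ⟨
    ((B₀ E.* P₀) E.* Q) E.* Z′     ≈⟨ ER.*-congʳ {Z′} (ER.*-assoc B₀ P₀ Q) ⟩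
    -- `zero ≤ j` computes to true, so `composeFrom zero τ` is the full composite that
    -- `at-*-product-P` produces.
    (B₀ E.* (P₀ E.* Q)) E.* Z′     ≈⟨ ER.*-cong (at-*-product-P (X zero) (s zero) a b) Z′≈Z ⟩
    ((P₀ E.* Q) E.* B₀′) E.* Z     ≈⟨ ER.*-assoc (P₀ E.* Q) B₀′ Z ⟩
    (P₀ E.* Q) E.* (B₀′ E.* Z)     ∎
    where
    open SetoidReasoning ER.setoid
    τ : Fin (suc h) → Permutation′ k
    τ j = Perm.transpose (a j) (b j)
    B₀ P₀ Q B₀′ Z Z′ : E.Carrier
    B₀  = X zero at s zero
    P₀  = P (a zero) (b zero)
    Q   = productᴱ λ j → P (a (suc j)) (b (suc j))
    B₀′ = X zero at (composeFrom zero τ ⟨$⟩ʳ s zero)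
    Z   = productᴱ λ i → X (suc i) at (composeFrom (suc i) τ ⟨$⟩ʳ s (suc i))
    Z′  = productᴱ λ i → X (suc i) at (composeFrom i (τ ∘ suc) ⟨$⟩ʳ s (suc i))
    Z′≈Z : Z′ E.≈ Z
    Z′≈Z = product-cong ER.semiring λ i → ER.reflexive $
      ≡.cong (X (suc i) at_) (≡.sym (composeFrom-suc i τ (s (suc i))))

  -- The coefficient c_{aj} of P_{aj} in Π_a, with w in place of 1/(n-2u-2+a).
  weight : ∀ {h} → Carrier → Fin h → Fin h → Carrier
  weight w a j = if does (a Fin.≤? j) then (if does (a Fin.<? j) then w else 1#) else 0#

  central-weight : ∀ {h w} (a j : Fin h) → Central w → Central (weight w a j)
  central-weight a j cw with does (a Fin.≤? j) | does (a Fin.<? j)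
  ... | true  | true  = cw
  ... | true  | false = central-1
  ... | false | _     = central-0

  -- The leading 1 becomes the term `j ≡ a`, because `P a a` is the identity. Terms with `j` below
  -- `a` get weight 0, so the sum can run over the whole of `Fin k` and `product-sum` applies.
  partialSum-weights : ∀ r w a → w ≈ - r →
    (E.1# E.+ E.- (r • sumᴱ (λ j → if does (a Fin.<? j) then P a j else E.0#))) E.≈
    sumᴱ (λ j → weight w a j • P a j)
  partialSum-weights r w a w≈-r = begin
    E.1# E.+ E.- (r • sumᴱ off)
      ≈⟨ ER.+-cong (ER.sym 1≈sum) (neg-•-sum r off) ⟩
    sumᴱ diag E.+ sumᴱ (λ j → (- r) • off j)
      ≈⟨ SemiringSum.∑-distrib-+ ER.semiring diag (λ j → (- r) • off j) ⟨
    sumᴱ (λ j → diag j E.+ ((- r) • off j))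
      ≈⟨ SemiringSum.sum-cong-≋ ER.semiring summand ⟩
    sumᴱ (λ j → weight w a j • P a j) ∎
    where
    open SetoidReasoning ER.setoid
    off diag : Fin k → E.Carrier
    off j  = if does (a Fin.<? j) then P a j else E.0#
    diag j = if does (a Fin.≟ j) then E.1# else E.0#

    1≈sum : sumᴱ diag E.≈ E.1#
    1≈sum = ER.trans
      (sum-single ER.semiring diag a λ j j≢a → ER.reflexive (if-no (a Fin.≟ j) (j≢a ∘ ≡.sym)))
      (ER.reflexive (if-yes (a Fin.≟ a) ≡.refl))

    summand : ∀ j → (diag j E.+ ((- r) • off j)) E.≈ (weight w a j • P a j)
    -- Above the diagonal only the `- r` term survives, on it only the unit, below it neither.
    summand j with Fin.<-cmp a j
    ... | tri< a<j a≢j _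
      rewrite dec-false (a Fin.≟ j) a≢j | dec-true (a Fin.<? j) a<j
            | dec-true (a Fin.≤? j) (ℕ.<⇒≤ a<j) =
      λ I J → trans (+-identityˡ _) (*-congʳ (sym w≈-r))
    ... | tri≈ a≮j ≡.refl _
      rewrite dec-true (a Fin.≟ a) ≡.refl | dec-false (a Fin.<? a) a≮j
            | dec-true (a Fin.≤? a) ℕ.≤-refl =
      λ I J → trans (+-congˡ (zeroʳ _)) (trans (+-identityʳ _)
                (trans (sym (P-diagonal a I J)) (sym (*-identityˡ _))))
    ... | tri> a≮j a≢j j<a
      rewrite dec-false (a Fin.≟ j) a≢j | dec-false (a Fin.<? j) a≮j
            | dec-false (a Fin.≤? j) (ℕ.<⇒≱ j<a) =
      λ I J → trans (+-identityˡ _) (trans (zeroʳ _) (sym (zeroˡ _)))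

  -- No index lies beyond the last one. This supplies the hypothesis of `interleavedProduct-last`.
  partialSum-last : ∀ r a → suc (toℕ a) ≡ k →
    (E.1# E.+ E.- (r • sumᴱ (λ j → if does (a Fin.<? j) then P a j else E.0#))) E.≈ E.1#
  partialSum-last r a a-last I J = begin
    E.1# I J + - (r * sumᴱ off I J) ≈⟨ +-congˡ (-‿cong (*-congˡ (sum≈0 I J))) ⟩
    E.1# I J + - (r * 0#)           ≈⟨ +-congˡ (trans (-‿cong (zeroʳ r)) -0#≈0#) ⟩
    E.1# I J + 0#                   ≈⟨ +-identityʳ _ ⟩
    E.1# I J                        ∎
    where
    open SetoidReasoning setoid
    off : Fin k → E.Carrier
    off j = if does (a Fin.<? j) then P a j else E.0#
    sum≈0 : sumᴱ off E.≈ E.0#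
    sum≈0 = sum-zero ER.semiring off λ j → ER.reflexive $
      if-no (a Fin.<? j) λ a<j → ℕ.<⇒≱ (Fin.toℕ<n j) (ℕ.≤-trans (ℕ.≤-reflexive (≡.sym a-last)) a<j)

-- The expansion over the reflection algebra.

module ExpansionProperties {c ℓ₁ ℓ₂} (K : HeytingField c ℓ₁ ℓ₂) (char0 : CharacteristicZero K)
                           (m l : ℕ) where
  open Expansion K char0 m l
  open Presentation K m l using (scal-central)
  private
    module B = Ring 𝓑
    module S = SeriesProperties 𝓑
    module SR = Ring S.seriesRing
    module T = TensorEndProperties S.seriesRing n n
    module TR = Ring T.tensorEndRing
    module CB = Centre 𝓑
    module CS = Centre S.seriesRing
  open SeriesOps B.rawRing
  open RawSemiringDefs (RawRing.rawSemiring SR.rawRing) using () renaming (product to productˢ)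

  -- The value of 2u at which 1/(n - 2u - 2 + i) is singular.
  pole : Fin n → B.Carrier
  pole i = fromℕ n B.- fromℕ 2 B.+ fromℕ (num i)

  -- The expansion of 1/(2u - i - n + 2), the coefficient in Π_i; `α[ i ]` below expands 1/(n - 2u -
  -- 2 + i).
  r[_] : Fin n → SR.Carrier
  r[ i ] = recip ½ (fromℕ 2 B.- fromℕ (num i) B.- fromℕ n)

  α[_] : Fin n → SR.Carrier
  α[ i ] = recip (B.- ½) (pole i)

  -- The coefficients are built from the scalar `½` and integer multiples of 1, all central in `𝓑`.
  central-α : ∀ i → CS.Central α[ i ]
  central-α i = S.central-coeffs α[ i ] $ S.central-recip
    (CB.central-neg (scal-central _))
    (CB.central-+ (CB.central-+ (CB.central-× n CB.central-1)
                                (CB.central-neg (CB.central-× 2 CB.central-1)))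
                  (CB.central-× (num i) CB.central-1))

  -- The denominators n - 2u - 2 + i and 2u - i - n + 2 are opposite; this accounts for the minus
  -- sign in Π_i.
  α≈-recip : ∀ i → α[ i ] SR.≈ SR.- r[ i ]
  α≈-recip i = SR.trans (S.recip-neg ½ (pole i)) (SR.-‿cong (S.recip-congʳ -pole))
    where
    open AbelianGroupProperties B.+-abelianGroup
    open SetoidReasoning B.setoid
    x y z : B.Carrier
    x = fromℕ n
    y = fromℕ 2
    z = fromℕ (num i)
    -pole : B.- (x B.- y B.+ z) B.≈ y B.- z B.- x
    -pole = begin
      B.- (x B.- y B.+ z)         ≈⟨ ⁻¹-∙-comm (x B.- y) z ⟨
      B.- (x B.- y) B.+ B.- z     ≈⟨ B.+-congʳ (⁻¹-anti-homo‿- x y) ⟩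
      (y B.- x) B.- z             ≈⟨ B.+-assoc y (B.- x) (B.- z) ⟩
      y B.+ (B.- x B.+ B.- z)     ≈⟨ B.+-congˡ (B.+-comm (B.- x) (B.- z)) ⟩
      y B.+ (B.- z B.+ B.- x)     ≈⟨ B.+-assoc y (B.- z) (B.- x) ⟨
      y B.- z B.- x               ∎

  w : Fin n → Fin n → SR.Carrier
  w i = T.weight α[ i ] i

  -- Outside I_n some entry lies below its index, and its zero weight kills the whole product. On
  -- I_n every outer test of `w` succeeds, leaving the factors of `α κ`.
  ∑-w≈∑[Iₙ] : ∀ (f : Vec (Fin n) n → Carrier) →
    ∑Vec +-rawMonoid n (λ κ → productˢ (λ i → w i (lookup κ i)) • f κ) ≈ ∑[Iₙ] λ κ → α κ • f κ
  ∑-w≈∑[Iₙ] f = ∑-cong TR.semiring n λ κ → term κ (κ ∈Iₙ?)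
    where
    -- The decision is an argument, so that matching on it reduces the conditional in the goal.
    term : ∀ κ (κ∈Iₙ? : Dec (κ ∈Iₙ)) → (productˢ (λ i → w i (lookup κ i)) • f κ) ≈
                                       (if does κ∈Iₙ? then α κ • f κ else 0#)
    term κ (yes κ∈) = T.•-cong
      (product-cong SR.semiring λ i → SR.reflexive (if-yes (i Fin.≤? lookup κ i) (κ∈ i)))
      (TR.refl {f κ})
    term κ (no κ∉) with Fin.¬∀⟶∃¬ n _ (λ i → i Fin.≤? lookup κ i) κ∉
    ... | i , i≰ = λ I J → SR.trans
      (SR.*-congʳ {f κ I J} (product-zero SR.semiring (λ i → w i (lookup κ i)) i
        (SR.reflexive (if-no (i Fin.≤? lookup κ i) i≰))))
      (SR.zeroˡ (f κ I J))

  expansion : ⟪B₁,…,Bₙ⟫ ≈ ∑[Iₙ] λ κ →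
    α κ • (Q⁻¹ κ * product λ i → B[u- toℕ i ] at (q[ i ] κ ⟨$⟩ʳ i))
  expansion = begin
    ⟪B₁,…,Bₙ⟫
      ≈⟨ interleavedProduct-last T.tensorEndRing b Π (λ i → T.partialSum-last r[ i ] i) ⟩
    product (λ i → b i * Π i)
      ≈⟨ product-cong TR.semiring (λ i → TR.trans
           (TR.*-congˡ {b i} (T.partialSum-weights r[ i ] α[ i ] i (α≈-recip i)))
           (SemiringSum.*-distribˡ-sum TR.semiring (b i) (λ j → w i j • P i j))) ⟩
    product (λ i → sum λ j → b i * (w i j • P i j))
      -- From here the sum runs over all n-tuples; it is cut down to I_n in the last step.
      ≈⟨ product-sum TR.semiring n (λ i j → b i * (w i j • P i j)) ⟩
    ∑Vec +-rawMonoid n (λ κ → product λ i → b i * (w i (lookup κ i) • P i (lookup κ i)))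
      ≈⟨ ∑-cong TR.semiring n (λ κ → TR.trans
           (T.product-• (λ i → w i (lookup κ i))
                        (λ i → T.central-weight i (lookup κ i) (central-α i))
                        b (λ i → P i (lookup κ i)))
           (T.•-cong (SR.refl {productˢ (λ i → w i (lookup κ i))})
             -- With these transpositions `composeFrom i` is `q[ i ] κ` by definition.
             (T.product-at-P (λ i → B[u- toℕ i ]) (λ i → i) (λ i → i) (lookup κ)))) ⟩
    ∑Vec +-rawMonoid n (λ κ → productˢ (λ i → w i (lookup κ i)) •
      (Q⁻¹ κ * product λ i → B[u- toℕ i ] at (q[ i ] κ ⟨$⟩ʳ i)))
      ≈⟨ ∑-w≈∑[Iₙ] (λ κ → Q⁻¹ κ * product λ i → B[u- toℕ i ] at (q[ i ] κ ⟨$⟩ʳ i)) ⟩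
    ∑[Iₙ] (λ κ → α κ • (Q⁻¹ κ * product λ i → B[u- toℕ i ] at (q[ i ] κ ⟨$⟩ʳ i))) ∎
    where
    open SetoidReasoning TR.setoid
    b : Fin n → Carrier
    b i = B[u- toℕ i ] at i

proposition3 : ∀ {c ℓ₁ ℓ₂} (K : HeytingField c ℓ₁ ℓ₂) (char0 : CharacteristicZero K) (m l : ℕ) →
    let open Expansion K char0 m l in
    ⟪B₁,…,Bₙ⟫ ≈ ∑[Iₙ] λ κ →
    α κ • (Q⁻¹ κ * product λ i → B[u- toℕ i ] at (q[ i ] κ ⟨$⟩ʳ i))
proposition3 = ExpansionProperties.expansion
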